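{- Let $n,p\geq1$ and $d\geq3$ be integers. Then $$\mathcal{N}(n[\{d\}p])\leq 2_{d-3}^{\,2\frac{p^{n+1}-1}{p-1}-1},$$ where for $p=1$ the quotient $\frac{p^{n+1}-1}{p-1}$ stands for $\sum_{k=0}^np^k=n+1$.
   Context: **Towers.** $2_0^x=x$ and $2_{k+1}^x=2^{(2_k^x)}$. **Skeletons.** A skeleton is a finite rooted tree whose nodes and edges are labeled by natural numbers; $n[\{d_1\}a_1,\dots,\{d_p\}a_p]$ denotes the skeleton with root label $n$ and subtrees $a_1,\dots,a_p$ attached by edges labeled $d_1,\dots,d_p$ (up to permutation of subtrees). A number $n$ also denotes the skeleton $n[\,]$; so $n[\{d\}p]$ has a root labeled $n$ with a single child, a leaf labeled $p$, along an edge labeled $d$. For $a=n[\{d_1\}a_1,\dots,\{d_p\}a_p]$, $a\cdot_d b$ denotes $n[\{d_1\}a_1,\dots,\{d_p\}a_p,\{d\}b]$. **Reduction.** Whenever $n\geq1$ and $d_i\geq 1$: $$n[\{d_1\}a_1,\dots,\{d_p\}a_p]\leadsto a_i\cdot_{d_i-1}(n-1)[\{d_1\}a_1,\dots,\{d_p\}a_p],$$ performed only at the root of the whole tree. $\mathcal{N}(a)\in\mathbb{N}\cup\{+\infty\}$ is the length of the longest reduction sequence starting from $a$. -}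

module Defs where

open import Data.List.Base using (List; []; _∷_; map; sum; upTo)
open import Data.List.Membership.Propositional using (_∈_)
open import Data.List.Relation.Binary.Permutation.Homogeneous using (Permutation)
open import Data.Nat.Base using (ℕ; zero; suc; _+_; _∸_; _^_; _/_; _≤_)
open import Data.Product.Base using (_×_; _,_; ∃)
open import Data.Product.Relation.Binary.Pointwise.NonDependent using (Pointwise)
open import Relation.Binary.PropositionalEquality.Core using (_≡_)
open import Relation.Nullary.Construct.Add.Supremum using (_⁺; [_]; ⊤⁺)
import Relation.Binary.Construct.Add.Supremum.NonStrict as AddSupremum

open AddSupremum _≤_ public using (_≤⁺_)

tower : ℕ → ℕ → ℕ
tower zero    x = x
tower (suc k) x = 2 ^ tower k x

-- node n ((d₁ , a₁) ∷ … ∷ (dₚ , aₚ) ∷ []) is the skeleton n[{d₁}a₁,…,{dₚ}aₚ];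
-- each edge label is stored with the subtree below that edge.
data Skeleton : Set where
  node : ℕ → List (ℕ × Skeleton) → Skeleton

leaf : ℕ → Skeleton
leaf n = node n []

-- Subtrees are unordered: equality of skeletons is equality up to permuting
-- the subtrees at every node.
infix 4 _≈_
data _≈_ : Skeleton → Skeleton → Set where
  node : ∀ {n as bs} →
         Permutation (Pointwise _≡_ _≈_) as bs → node n as ≈ node n bs

-- New subtrees go to the front of the list, which is immaterial up to _≈_.
infixl 6 _·⟨_⟩_
_·⟨_⟩_ : Skeleton → ℕ → Skeleton → Skeleton
node n as ·⟨ d ⟩ b = node n ((d , b) ∷ as)

-- Reduction is a relation between skeletons up to _≈_, hence the two
-- _≈_ premises.  The conditions n ≥ 1 and dᵢ ≥ 1 are expressed by suc.
infix 4 _⇝_ _⇝[_]_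
data _⇝_ (a b : Skeleton) : Set where
  reduce : ∀ {n d c as} →
           a ≈ node (suc n) as →
           (suc d , c) ∈ as →
           b ≈ c ·⟨ d ⟩ node n as →
           a ⇝ b

-- a ⇝[ k ] b : there is a reduction sequence from a to b with k steps.
data _⇝[_]_ (a : Skeleton) : ℕ → Skeleton → Set where
  done : a ⇝[ 0 ] a
  step : ∀ {b c k} → a ⇝ b → b ⇝[ k ] c → a ⇝[ suc k ] c

-- 𝒩[ a ]≔ v is the graph of the map 𝒩 from skeletons to ℕ ∪ {+∞}, with ⊤⁺ for
-- +∞.  The map itself is not given as a function, since computing it
-- presupposes deciding whether the lengths are bounded.
infix 4 𝒩[_]≔_
data 𝒩[_]≔_ (a : Skeleton) : ℕ ⁺ → Set where
  longest   : ∀ {m} →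
              ∃ (λ b → a ⇝[ m ] b) →
              (∀ {k b} → a ⇝[ k ] b → k ≤ m) →
              𝒩[ a ]≔ [ m ]
  unbounded : (∀ m → ∃ (λ b → a ⇝[ m ] b)) → 𝒩[ a ]≔ ⊤⁺

-- (p ^ (n + 1) - 1) / (p - 1) for p ≥ 2, where the division is exact, and
-- p ^ 0 + … + p ^ n for p = 1.  The value at p = 0 is not used.
geometric : ℕ → ℕ → ℕ
geometric (suc (suc q)) n = (suc (suc q) ^ (n + 1) ∸ 1) / suc q
geometric p             n = sum (map (p ^_) (upTo (suc n)))

-- As in the cut-elimination method, derivations ρ ⊢ a ∶ α assign heights α to
-- skeletons: attaching a subtree to the root along an edge labelled 1, …, ρ is a
-- cut, and heights add up across cuts.  Since n[{d}p] reduces to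
-- p[{d-1}(n-1)[{d}p]], and (j+1)[{d-1}x] reduces to x ·_{d-2} j[{d-1}x], n[{d}p]
-- has a derivation of rank d-2 whose height hₙ obeys h₀ = 0 and
-- hₙ₊₁ = 1 + p (1 + hₙ), so hₙ ≤ 2 (1 + p + … + pⁿ) - 2.  Lowering the rank by one
-- costs one exponential, except that cuts of label 1 are eliminated for free:
-- entering a subtree through such an edge leaves the rest behind an edge labelled
-- 0, which is never crossed.  At rank 0 the height bounds the length of every
-- reduction sequence.
module Submission where

open import Defs
open import Data.Empty using (⊥)
open import Data.List.Base using (List; []; _∷_; map; upTo; length)
open import Data.List.Membership.Propositional using (_∈_; find)
open import Data.List.Properties using (length-upTo)
open import Data.List.Relation.Binary.Permutation.Homogeneous using (Permutation; refl; prep; swap; trans)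
open import Data.List.Relation.Binary.Pointwise.Base using ([]; _∷_) renaming (Pointwise to ListPointwise)
open import Data.List.Relation.Unary.Any as Any using (Any; here; there)
open import Data.List.Relation.Unary.Any.Properties using (lift-resp)
open import Data.Nat.Base
open import Data.Nat.DivMod using (m*n/n≡m)
open import Data.Nat.ListAction using (sum)
open import Data.Nat.Properties
open import Data.Nat.Tactic.RingSolver using (solve-∀)
open import Data.Product.Base using (∃; _×_; _,_; proj₁)
open import Data.Product.Relation.Binary.Pointwise.NonDependent using (Pointwise)
open import Data.Sum.Base using (_⊎_; inj₁; inj₂)
open import Data.Unit.Base using (⊤; tt)
import Relation.Binary.Construct.Add.Supremum.NonStrict as AddSupremum
open import Relation.Binary.Definitions using (_Respects_)
open import Relation.Binary.PropositionalEquality as ≡ using (_≡_; refl; cong; subst)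
open import Relation.Nullary.Construct.Add.Supremum using ([_])
open import Relation.Nullary.Decidable using (Dec; yes; no)
open import Relation.Unary using (Decidable)

open AddSupremum _≤_ using () renaming ([_] to [_]≤⁺)

private
  variable
    a a′ b b′ c x : Skeleton
    as as′ bs : List (ℕ × Skeleton)
    d e n ρ α β γ : ℕ

-- Equality of skeletons

Edge : Set
Edge = ℕ × Skeleton

infix 4 _≈ₑ_ _↭_
_≈ₑ_ : Edge → Edge → Set
_≈ₑ_ = Pointwise _≡_ _≈_

_↭_ : List Edge → List Edge → Set
_↭_ = Permutation _≈ₑ_

mutual
  ≈-refl : a ≈ a
  ≈-refl {node n as} = node (refl ≈ₑ-refl)

  ≈ₑ-refl : ListPointwise _≈ₑ_ as as
  ≈ₑ-refl {[]}           = []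
  ≈ₑ-refl {(d , a) ∷ as} = (refl , ≈-refl) ∷ ≈ₑ-refl

mutual
  ≈-sym : a ≈ b → b ≈ a
  ≈-sym (node p) = node (↭-sym p)

  ↭-sym : as ↭ bs → bs ↭ as
  ↭-sym (refl ps)                         = refl (≈ₑ-sym ps)
  ↭-sym (prep (refl , q) p)               = prep (refl , ≈-sym q) (↭-sym p)
  ↭-sym (swap (refl , q) (refl , r) p)    = swap (refl , ≈-sym r) (refl , ≈-sym q) (↭-sym p)
  ↭-sym (trans p q)                       = trans (↭-sym q) (↭-sym p)

  ≈ₑ-sym : ListPointwise _≈ₑ_ as bs → ListPointwise _≈ₑ_ bs as
  ≈ₑ-sym []                = []
  ≈ₑ-sym ((refl , q) ∷ ps) = (refl , ≈-sym q) ∷ ≈ₑ-sym ps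

·-cong : a ≈ a′ → b ≈ b′ → a ·⟨ d ⟩ b ≈ a′ ·⟨ d ⟩ b′
·-cong (node p) q = node (prep (refl , q) p)

Any-resp-↭ : ∀ {P : Edge → Set} → P Respects _≈ₑ_ → Any P Respects _↭_
Any-resp-↭ resp (refl ps)    i                 = lift-resp resp ps i
Any-resp-↭ resp (prep q p)   (here i)          = here (resp q i)
Any-resp-↭ resp (prep q p)   (there i)         = there (Any-resp-↭ resp p i)
Any-resp-↭ resp (swap q r p) (here i)          = there (here (resp q i))
Any-resp-↭ resp (swap q r p) (there (here i))  = here (resp r i)
Any-resp-↭ resp (swap q r p) (there (there i)) = there (there (Any-resp-↭ resp p i))
Any-resp-↭ resp (trans p q)  i                 = Any-resp-↭ resp q (Any-resp-↭ resp p i)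

-- Decidability of the existence of reduction sequences of given length

mutual
  -- Existence of a sequence of `k` steps on the list representation, without `_≈_`. A node has
  -- finitely many children, which makes this decidable.
  Run : ℕ → Skeleton → Set
  Run zero    _                 = ⊤
  Run (suc k) (node zero as)    = ⊥
  Run (suc k) (node (suc n) as) = Any (RunVia k n as) as

  RunVia : ℕ → ℕ → List Edge → Edge → Set
  RunVia k n as (zero  , c) = ⊥
  RunVia k n as (suc d , c) = Run k (c ·⟨ d ⟩ node n as)

mutual
  run? : ∀ k a → Dec (Run k a)
  run? zero    _                 = yes tt
  run? (suc k) (node zero as)    = no λ ()
  run? (suc k) (node (suc n) as) = Any.any? (runVia? k n as) as

  runVia? : ∀ k n as → Decidable (RunVia k n as)
  runVia? k n as (zero  , c) = no λ ()
  runVia? k n as (suc d , c) = run? k (c ·⟨ d ⟩ node n as)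

Run-resp-≈ : ∀ k → Run k Respects _≈_
Run-resp-≈ zero    _                           _ = tt
Run-resp-≈ (suc k) (node {suc n} {as} {bs} p)  r =
  -- The chosen child is first carried along the permutation with the old root still holding `as`;
  -- `transport` then replaces `as` by `bs` in the reduct.
  Any.map (λ {x} → transport x) (Any-resp-↭ resp p r)
  where
  resp : RunVia k n as Respects _≈ₑ_
  resp {suc d , _} (refl , q) = Run-resp-≈ k (·-cong q ≈-refl)

  transport : ∀ x → RunVia k n as x → RunVia k n bs x
  transport (suc d , c) = Run-resp-≈ k (·-cong (≈-refl {c}) (node p))

Run⇒⇝ : ∀ k a → Run k a → ∃ λ b → a ⇝[ k ] b
Run⇒⇝ zero    a                 _ = a , done
Run⇒⇝ (suc k) (node (suc n) as) r with find r
... | (suc d , c) , i , r′ with Run⇒⇝ k _ r′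
...   | b , s = b , step (reduce ≈-refl i ≈-refl) s

⇝⇒Run : ∀ {k} → a ⇝[ k ] b → Run k a
⇝⇒Run done = tt
⇝⇒Run {k = suc k} (step (reduce {n} {d} {c} {as} p i q) s) =
  Run-resp-≈ (suc k) (≈-sym p)
    (Any.map (λ { refl → Run-resp-≈ k q (⇝⇒Run s) }) i)

greatest : ∀ {P : ℕ → Set} → Decidable P → P 0 → ∀ B → (∀ {k} → P k → k ≤ B) →
           ∃ λ m → P m × (∀ {k} → P k → k ≤ m) × m ≤ B
greatest P? P0 zero    bound = 0 , P0 , bound , z≤n
greatest {P} P? P0 (suc B) bound with P? (suc B)
... | yes PB = suc B , PB , bound , ≤-refl
... | no ¬PB with greatest P? P0 B
                  (λ {k} Pk → s≤s⁻¹ (≤∧≢⇒< (bound Pk) λ k≡ → ¬PB (subst P k≡ Pk)))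
...   | m , Pm , max , m≤B = m , Pm , max , m≤n⇒m≤1+n m≤B

-- `longest` demands an attained maximum; `run?` finds it by searching downwards from `B`.
bounded⇒𝒩 : ∀ {B} → (∀ {k} → Run k a → k ≤ B) →
            ∃ λ v → (𝒩[ a ]≔ v) × (v ≤⁺ [ B ])
bounded⇒𝒩 {a} {B} bound with greatest (λ k → run? k a) tt B bound
... | m , r , max , m≤B = [ m ] , longest (Run⇒⇝ m a r) (λ s → max (⇝⇒Run s)) , [ m≤B ]≤⁺

-- Derivations

-- Grafting can put new edges in front of a cut or dead edge, so the rules allow that edge at any
-- position.
data Insert (x : Edge) : List Edge → List Edge → Set where
  here  : Insert x as (x ∷ as)
  there : ∀ {y} → Insert x as as′ → Insert x (y ∷ as) (y ∷ as′)

-- The first premise of red accounts for leaving the root towards a subtree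
-- that is grafted onto it by a cut.
infix 4 _⊢_∶_
data _⊢_∶_ (ρ : ℕ) : Skeleton → ℕ → Set where
  halt : ρ ⊢ node 0 as ∶ α
  red  : ρ ⊢ node n as ∶ α →
         (∀ {d c} → (suc d , c) ∈ as → ρ ⊢ c ·⟨ d ⟩ node n as ∶ α) →
         ρ ⊢ node (suc n) as ∶ suc α
  dead : Insert (0 , b) as as′ → ρ ⊢ node n as ∶ α → ρ ⊢ node n as′ ∶ α
  cut  : e < ρ → α + β ≤ γ → Insert (suc e , b) as as′ →
         ρ ⊢ node n as ∶ α → ρ ⊢ b ∶ β → ρ ⊢ node n as′ ∶ γ

weaken : α ≤ β → ρ ⊢ a ∶ α → ρ ⊢ a ∶ β
weaken p       halt          = halt
weaken (s≤s p) (red D Ds)    = red (weaken p D) (λ i → weaken p (Ds i))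
weaken p       (dead i D)    = dead i (weaken p D)
weaken p       (cut l q i D E) = cut l (≤-trans q p) i D E

·-dead : ρ ⊢ b ∶ α → ρ ⊢ b ·⟨ 0 ⟩ x ∶ α
·-dead {b = node _ _} = dead here

·-cut : e < ρ → ρ ⊢ a ∶ α → ρ ⊢ b ∶ β → ρ ⊢ a ·⟨ suc e ⟩ b ∶ α + β
·-cut {a = node _ _} l = cut l ≤-refl here

-- a ⊲ a′: a′ arises from a by attaching subtrees satisfying P at any nodes.
module Grafting (P : Edge → Set) where
  infix 4 _⊲_ _⊲ₗ_
  mutual
    data _⊲_ : Skeleton → Skeleton → Set where
      node : as ⊲ₗ as′ → node n as ⊲ node n as′

    data _⊲ₗ_ : List Edge → List Edge → Set where
      []    : [] ⊲ₗ []
      keep  : a ⊲ a′ → as ⊲ₗ as′ → (d , a) ∷ as ⊲ₗ (d , a′) ∷ as′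
      graft : ∀ {y} → P y → as ⊲ₗ as′ → as ⊲ₗ y ∷ as′

  mutual
    ⊲-refl : a ⊲ a
    ⊲-refl {node n as} = node ⊲ₗ-refl

    ⊲ₗ-refl : as ⊲ₗ as
    ⊲ₗ-refl {[]}           = []
    ⊲ₗ-refl {(d , a) ∷ as} = keep ⊲-refl ⊲ₗ-refl

  ·-⊲ : a ⊲ a′ → b ⊲ b′ → a ·⟨ d ⟩ b ⊲ a′ ·⟨ d ⟩ b′
  ·-⊲ (node p) q = node (keep q p)

  Insert⇒⊲ₗ : ∀ {y} → P y → Insert y as as′ → as ⊲ₗ as′
  Insert⇒⊲ₗ Py here      = graft Py ⊲ₗ-refl
  Insert⇒⊲ₗ Py (there i) = keep ⊲-refl (Insert⇒⊲ₗ Py i)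

  ⊲ₗ-∈ : as ⊲ₗ as′ → (d , c) ∈ as′ → P (d , c) ⊎ ∃ λ c₀ → (d , c₀) ∈ as × c₀ ⊲ c
  ⊲ₗ-∈ (keep p ps)  (here refl) = inj₂ (_ , here refl , p)
  ⊲ₗ-∈ (graft q ps) (here refl) = inj₁ q
  ⊲ₗ-∈ (graft q ps) (there i)   = ⊲ₗ-∈ ps i
  ⊲ₗ-∈ (keep p ps)  (there i) with ⊲ₗ-∈ ps i
  ... | inj₁ q            = inj₁ q
  ... | inj₂ (c₀ , j , q) = inj₂ (c₀ , there j , q)

  Insert-⊲ₗ : Insert (d , b) as bs → bs ⊲ₗ as′ →
              ∃ λ b′ → b ⊲ b′ × ∃ λ as₀ → as ⊲ₗ as₀ × Insert (d , b′) as₀ as′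
  Insert-⊲ₗ here      (keep p ps) = _ , p , _ , ps , here
  Insert-⊲ₗ (there i) (keep p ps) with Insert-⊲ₗ i ps
  ... | b′ , q , as₀ , qs , j = b′ , q , _ , keep p qs , there j
  Insert-⊲ₗ i         (graft r ps) with Insert-⊲ₗ i ps
  ... | b′ , q , as₀ , qs , j = b′ , q , _ , graft r qs , there j

  Insert-⊲ₗ-graft : (∀ {b} → P (d , b)) → Insert (d , b) as bs → bs ⊲ₗ as′ → as ⊲ₗ as′
  Insert-⊲ₗ-graft Pd here      (keep p ps)  = graft Pd ps
  Insert-⊲ₗ-graft Pd (there i) (keep p ps)  = keep p (Insert-⊲ₗ-graft Pd i ps)
  Insert-⊲ₗ-graft Pd i         (graft r ps) = graft r (Insert-⊲ₗ-graft Pd i ps)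

-- Cut elimination

-- g α is the height after grafting b, and δ α that of the reducts of a grafted
-- skeleton of height suc α; jump covers the reduction into a copy of b.
module _
  (b : Skeleton) (g δ : ℕ → ℕ)
  (g-suc : ∀ α → g (suc α) ≡ suc (δ α))
  (g≤δ : ∀ α → g α ≤ δ α)
  (g-+ : ∀ {e α β γ} → e < ρ → α + β ≤ γ → g α + g β ≤ g γ)
  (jump : ∀ {x α} → ρ ⊢ x ∶ g α → ρ ⊢ b ·⟨ ρ ⟩ x ∶ δ α)
  where
  open Grafting (_≡ (suc ρ , b))

  -- A reduction copies the visited subtree and moves the old root downwards, so copies of `b`
  -- spread to many nodes; the induction treats all of them at once.
  graft-⊢ : a ⊲ a′ → ρ ⊢ a ∶ α → ρ ⊢ a′ ∶ g α
  graft-⊢ (node ps) halt = halt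
  graft-⊢ (node {as′ = as′} ps) (red {n = n} {α = α} D Ds) =
    subst (ρ ⊢ _ ∶_) (≡.sym (g-suc α)) (red (weaken (g≤δ α) D′) reducts)
    where
    D′ = graft-⊢ (node ps) D

    reducts : ∀ {d c} → (suc d , c) ∈ as′ → ρ ⊢ c ·⟨ d ⟩ node n as′ ∶ δ α
    reducts i with ⊲ₗ-∈ ps i
    ... | inj₁ refl         = jump D′
    ... | inj₂ (c₀ , j , p) = weaken (g≤δ α) (graft-⊢ (·-⊲ p (node ps)) (Ds j))
  graft-⊢ (node ps) (dead i D) with Insert-⊲ₗ i ps
  ... | _ , _ , _ , qs , j = dead j (graft-⊢ (node qs) D)
  graft-⊢ (node ps) (cut l q i D E) with Insert-⊲ₗ i ps
  ... | _ , p , _ , qs , j = cut l (g-+ l q) j (graft-⊢ (node qs) D) (graft-⊢ p E)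

  insert-⊢ : Insert (suc ρ , b) as as′ → ρ ⊢ node n as ∶ α → ρ ⊢ node n as′ ∶ g α
  insert-⊢ i = graft-⊢ (node (Insert⇒⊲ₗ refl i))

-- Entering `b` leaves the old root behind an edge labelled 0, hence dead, so `β` is paid only once.
insert-⊢-zero : Insert (1 , b) as as′ → 0 ⊢ node n as ∶ α → 0 ⊢ b ∶ β → 0 ⊢ node n as′ ∶ α + β
insert-⊢-zero {b} {β = β} i D E =
  insert-⊢ b (_+ β) (_+ β) (λ _ → refl) (λ _ → ≤-refl) (λ ())
    (λ {_} {α} _ → ·-dead (weaken (m≤n+m β α) E)) i D

-- Entering `b` attaches the old root by a cut of label `suc ρ`, so `b` can be entered again later:
-- `g (suc α) = suc (β + g α)`.
insert-⊢-suc : Insert (2 + ρ , b) as as′ → suc ρ ⊢ node n as ∶ α → suc ρ ⊢ b ∶ β →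
               suc ρ ⊢ node n as′ ∶ α * suc β
insert-⊢-suc {b = b} {β = β} i D E =
  insert-⊢ b (_* suc β) (λ α → β + α * suc β) (λ _ → refl) (λ α → m≤n+m (α * suc β) β)
    (λ {_} {α} {α′} _ p → ≤-trans (≤-reflexive (≡.sym (*-distribʳ-+ (suc β) α α′))) (*-monoˡ-≤ (suc β) p))
    (·-cut ≤-refl E) i D

-- Cuts of label at most ρ survive, those of label suc ρ are handled by insert.
module _
  (h : ℕ → ℕ)
  (h-suc : ∀ α → h α < h (suc α))
  (h-+ : ∀ {e α β γ} → e < ρ → α + β ≤ γ → h α + h β ≤ h γ)
  (insert : ∀ {b as as′ n α β γ} → α + β ≤ γ → Insert (suc ρ , b) as as′ →
            ρ ⊢ node n as ∶ h α → ρ ⊢ b ∶ h β → ρ ⊢ node n as′ ∶ h γ)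
  where

  lower : suc ρ ⊢ a ∶ α → ρ ⊢ a ∶ h α
  lower halt = halt
  lower (red {α = α} D Ds) = weaken (h-suc α) (red (lower D) (λ i → lower (Ds i)))
  lower (dead i D) = dead i (lower D)
  lower (cut l q i D E) with m≤n⇒m<n∨m≡n (s≤s⁻¹ l)
  ... | inj₁ l′   = cut l′ (h-+ l′ q) i (lower D) (lower E)
  ... | inj₂ refl = insert q i (lower D) (lower E)

lower-zero : 1 ⊢ a ∶ α → 0 ⊢ a ∶ α
lower-zero = lower (λ α → α) (λ _ → ≤-refl) (λ ())
  (λ q i D E → weaken q (insert-⊢-zero i D E))

suc-pred-2^ : ∀ α → suc (pred (2 ^ α)) ≡ 2 ^ α
suc-pred-2^ α = suc-pred (2 ^ α) {{m^n≢0 2 α}}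

pred-2^-* : ∀ {α β γ} → α + β ≤ γ → pred (2 ^ α) * 2 ^ β ≤ pred (2 ^ γ)
pred-2^-* {α} {β} {γ} q = s≤s⁻¹ (begin
  suc (pred (2 ^ α) * 2 ^ β)     ≤⟨ +-monoˡ-≤ _ (m^n>0 2 β) ⟩
  suc (pred (2 ^ α)) * 2 ^ β     ≡⟨ cong (_* 2 ^ β) (suc-pred-2^ α) ⟩
  2 ^ α * 2 ^ β                  ≡⟨ ^-distribˡ-+-* 2 α β ⟨
  2 ^ (α + β)                    ≤⟨ ^-monoʳ-≤ 2 q ⟩
  2 ^ γ                          ≡⟨ suc-pred-2^ γ ⟨
  suc (pred (2 ^ γ))             ∎)
  where open ≤-Reasoning

-- For `u ≥ 1`, `u + v ≤ u * suc v`, which leads back to the product bound.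
pred-2^-+ : ∀ {α β γ} → α + β ≤ γ → pred (2 ^ α) + pred (2 ^ β) ≤ pred (2 ^ γ)
pred-2^-+ {zero}  {β} {γ} q = pred-mono-≤ (^-monoʳ-≤ 2 q)
pred-2^-+ {suc α} {β} {γ} q = begin
  u + v          ≡⟨ +-comm u v ⟩
  v + u          ≤⟨ +-mono-≤ (m≤n*m v u {{u≢0}}) (≤-refl {u}) ⟩
  u * v + u      ≡⟨ +-comm (u * v) u ⟩
  u + u * v      ≡⟨ *-suc u v ⟨
  u * suc v      ≡⟨ cong (u *_) (suc-pred-2^ β) ⟩
  u * 2 ^ β      ≤⟨ pred-2^-* {suc α} q ⟩
  pred (2 ^ γ)   ∎
  where
  open ≤-Reasoning
  u = pred (2 ^ suc α)
  v = pred (2 ^ β)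
  u≢0 : NonZero u
  u≢0 = >-nonZero (pred-mono-≤ (^-monoʳ-≤ 2 {1} {suc α} (s≤s z≤n)))

-- The predecessor gives `h 0 = 0`, which `h-+` forces, and `suc (h β) = 2 ^ β`, so that grafting
-- adds exponents.
lower-suc : suc (suc ρ) ⊢ a ∶ α → suc ρ ⊢ a ∶ pred (2 ^ α)
lower-suc = lower (λ α → pred (2 ^ α)) pred-2^-< (λ {_} {α} _ → pred-2^-+ {α})
  (λ {_} {_} {_} {_} {α} {β} q i D E →
    weaken (≤-trans (≤-reflexive (cong (pred (2 ^ α) *_) (suc-pred-2^ β))) (pred-2^-* {α} q))
      (insert-⊢-suc i D E))
  where
  pred-2^-< : ∀ α → pred (2 ^ α) < pred (2 ^ suc α)
  pred-2^-< α = s≤s⁻¹ (≡.subst₂ _<_ (≡.sym (suc-pred-2^ α)) (≡.sym (suc-pred-2^ (suc α)))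
    (^-monoʳ-< 2 ≤-refl (n<1+n α)))

-- `lower-tower` exponentiates at the top of the tower, while `tower` unfolds at the bottom.
tower-2^ : ∀ k x → tower k (2 ^ x) ≡ 2 ^ tower k x
tower-2^ zero    x = refl
tower-2^ (suc k) x = cong (2 ^_) (tower-2^ k x)

lower-tower : ∀ k → suc k ⊢ a ∶ α → 0 ⊢ a ∶ tower k α
lower-tower zero            D = lower-zero D
lower-tower {a} {α} (suc k) D = subst (0 ⊢ a ∶_) (tower-2^ k α)
  (lower-tower k (weaken pred[n]≤n (lower-suc D)))

-- Subtrees under edges labelled 0 are never visited.
open Grafting (λ y → proj₁ y ≡ 0)

-- At rank 0 there are no cuts, and each step uses up one `red`. The edge dropped by `dead` is still
-- present in the skeleton; `a ⊲ a′` counts it as a graft.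
⊢⇒Run-bounded : 0 ⊢ a ∶ α → a ⊲ a′ → ∀ k → Run k a′ → k ≤ α
⊢⇒Run-bounded D          p         zero    r = z≤n
⊢⇒Run-bounded halt       (node ps) (suc k) ()
⊢⇒Run-bounded (dead i D) (node ps) (suc k) r =
  ⊢⇒Run-bounded D (node (Insert-⊲ₗ-graft refl i ps)) (suc k) r
⊢⇒Run-bounded (red D Ds) (node ps) (suc k) r with find r
... | (suc d , c) , i , r′ with ⊲ₗ-∈ ps i
...   | inj₂ (c₀ , j , p) = s≤s (⊢⇒Run-bounded (Ds j) (·-⊲ p (node ps)) k r′)

-- The skeletons n[{d}p]

height : ℕ → ℕ → ℕ
height p zero    = 0
height p (suc n) = suc (p * suc (height p n))

leaf-⊢ : ∀ {k x α} → suc k ⊢ x ∶ α → ∀ j → suc k ⊢ leaf j ·⟨ 2 + k ⟩ x ∶ j * suc α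
leaf-⊢ D zero = halt
leaf-⊢ {k} {x} {α} D (suc j) = red (weaken (m≤n+m (j * suc α) α) (leaf-⊢ D j))
  (λ { (here refl) → ·-cut ≤-refl D (leaf-⊢ D j) })

node-⊢ : ∀ {p} k n → 1 ≤ p → suc k ⊢ node n ((3 + k , leaf p) ∷ []) ∶ height p n
node-⊢ k zero    1≤p = halt
node-⊢ {p} k (suc n) 1≤p =
  red (weaken (≤-trans (n≤1+n _) (m≤n*m (suc (height p n)) p {{>-nonZero 1≤p}})) D)
    (λ { (here refl) → leaf-⊢ D p })
  where D = node-⊢ k n 1≤p

-- Horner form of `p ^ 0 + … + p ^ n`, unfolding like `height`.
powerSum : ℕ → ℕ → ℕ
powerSum p zero    = 1
powerSum p (suc n) = 1 + p * powerSum p n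

powerSum-* : ∀ q n → 1 + powerSum (suc q) n * q ≡ suc q ^ (n + 1)
powerSum-* q zero    = identity q
  where
  identity : ∀ q → 1 + 1 * q ≡ (1 + q) * 1
  identity = solve-∀
powerSum-* q (suc n) = ≡.trans (identity q (powerSum (suc q) n)) (cong (suc q *_) (powerSum-* q n))
  where
  identity : ∀ q s → 1 + (1 + (1 + q) * s) * q ≡ (1 + q) * (1 + s * q)
  identity = solve-∀

powerSum-1 : ∀ n → powerSum 1 n ≡ suc n
powerSum-1 zero    = refl
powerSum-1 (suc n) = cong suc (≡.trans (+-identityʳ _) (powerSum-1 n))

sum-map-1^ : ∀ ks → sum (map (1 ^_) ks) ≡ length ks
sum-map-1^ []       = refl
sum-map-1^ (k ∷ ks) = ≡.cong₂ _+_ (^-zeroˡ k) (sum-map-1^ ks)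

geometric≡powerSum : ∀ {p} n → 1 ≤ p → geometric p n ≡ powerSum p n
geometric≡powerSum {1} n _ = ≡.trans (sum-map-1^ (upTo (suc n)))
  (≡.trans (length-upTo (suc n)) (≡.sym (powerSum-1 n)))
geometric≡powerSum {suc (suc q)} n _ =
  ≡.trans (cong (λ m → (m ∸ 1) / suc q) (≡.sym (powerSum-* (suc q) n)))
    (m*n/n≡m (powerSum (2 + q) n) (suc q))

-- As `1 ≤ p`, each step takes `2 + h` to at most `2 + p * (2 + h)`, the recursion of twice the
-- power sum.
2+height≤2*powerSum : ∀ {p} n → 1 ≤ p → 2 + height p n ≤ 2 * powerSum p n
2+height≤2*powerSum zero    _   = ≤-refl
2+height≤2*powerSum {p} (suc n) 1≤p = begin
  2 + suc (p * suc h)          ≤⟨ +-monoʳ-≤ 2 (+-monoˡ-≤ (p * suc h) 1≤p) ⟩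
  2 + (p + p * suc h)          ≡⟨ cong (2 +_) (*-suc p (suc h)) ⟨
  2 + p * (2 + h)              ≤⟨ +-monoʳ-≤ 2 (*-monoʳ-≤ p (2+height≤2*powerSum n 1≤p)) ⟩
  2 + p * (2 * powerSum p n)   ≡⟨ identity p (powerSum p n) ⟩
  2 * (1 + p * powerSum p n)   ∎
  where
  open ≤-Reasoning
  h = height p n
  identity : ∀ p s → 2 + p * (2 * s) ≡ 2 * (1 + p * s)
  identity = solve-∀

height≤geometric : ∀ {p} n → 1 ≤ p → height p n ≤ 2 * geometric p n ∸ 1
height≤geometric {p} n 1≤p = ≤-trans (n≤1+n _)
  (∸-monoˡ-≤ 1 (subst (λ s → 2 + height p n ≤ 2 * s) (≡.sym (geometric≡powerSum n 1≤p))
    (2+height≤2*powerSum n 1≤p)))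

theorem4p17 : ∀ (n p d : ℕ) → 1 ≤ n → 1 ≤ p → 3 ≤ d →
    ∃ (λ v → (𝒩[ node n ((d , leaf p) ∷ []) ]≔ v) × (v ≤⁺ [ tower (d ∸ 3) (2 * geometric p n ∸ 1) ]))
theorem4p17 n p (suc (suc (suc k))) _ 1≤p (s≤s (s≤s (s≤s z≤n))) =
  bounded⇒𝒩 (λ {m} → ⊢⇒Run-bounded (lower-tower k D) ⊲-refl m)
  where
  D : suc k ⊢ node n ((3 + k , leaf p) ∷ []) ∶ 2 * geometric p n ∸ 1
  D = weaken (height≤geometric n 1≤p) (node-⊢ k n 1≤p)
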